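{- Let $\mathbf a=(a_1,\dots,a_q)$ be a graceful permutation of length $q$. Suppose $\mathbf a$ has two adjacent entries $x$ and $y$ (in either order) with $x<y<2(y-x)$, and put $p=2(y-x)$. Then there is a graceful permutation of length $2p+q$ with first element $a_1+p$ and last element $a_q+p$.
   Context: A graceful permutation of length $n$ is an arrangement $(a_1,\dots,a_n)$ of the integers $\{0,1,\dots,n-1\}$ whose absolute differences $|a_{i+1}-a_i|$ ($1\le i\le n-1$) are exactly $\{1,\dots,n-1\}$. -}

module Defs where

open import Data.List.Base using (List; []; _∷_; _++_; upTo; applyUpTo)
open import Data.List.Relation.Binary.Permutation.Propositional using (_↭_)
open import Data.Nat.Base using (ℕ; suc; _∸_; ∣_-_∣)
open import Data.Product.Base using (∃₂)
open import Data.Sum.Base using (_⊎_)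
open import Relation.Binary.PropositionalEquality.Core using (_≡_)

differences : List ℕ → List ℕ
differences []           = []
differences (_ ∷ [])     = []
differences (a ∷ b ∷ as) = ∣ b - a ∣ ∷ differences (b ∷ as)

-- upTo n is 0, …, n - 1 and applyUpTo suc (n ∸ 1) is 1, …, n - 1.  There
-- are n - 1 differences, so they form the set {1, …, n - 1} exactly when
-- they are a rearrangement of that list.
record GracefulPermutation (n : ℕ) (as : List ℕ) : Set where
  field
    arrangement : as ↭ upTo n
    graceful    : differences as ↭ applyUpTo suc (n ∸ 1)

Consecutive : ℕ → ℕ → List ℕ → Set
Consecutive x y as = ∃₂ λ us vs → as ≡ us ++ x ∷ y ∷ vs

Adjacent : ℕ → ℕ → List ℕ → Set
Adjacent x y as = Consecutive x y as ⊎ Consecutive y x as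

{-# OPTIONS --safe #-}
module Submission where

-- Write p = 2 (y - x).  Shift the permutation by p and replace the edge between
-- x + p and y + p by a path that starts at the low label y, ends at the high
-- label y + p + q, and alternates between all the labels below p and all those
-- from p + q on.  The two joining edges have differences (x + p) - y = y - x, by
-- the choice of p, and q, so the inner edges must have the
-- differences q + 1, …, 2 p + q - 1.  When a high label is replaced by its
-- distance u from the top, this means that consecutive
-- entries l, u of the path have the sums 0, …, 2 p - 2.  Such paths exist with
-- any first entry i and last entry j, where i + j + 1 = p, by a Euclidean descent
-- on (i , j): i, i, i - 1, i - 1, …, 0, 0 followed by the path for (i , j) shifted
-- by i + 1 is the path for (i , i + j + 1), reversal exchanges i and j, and the
-- case i = j is explicit.

open import Defs
open import Data.List.Base
  using (List; []; _∷_; _++_; [_]; _∷ʳ_; map; concatMap; reverse; head; last; upTo; downFrom; applyUpTo)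
open import Data.List.Properties
open import Data.List.Relation.Binary.Permutation.Propositional
  using (_↭_; ↭-refl; ↭-reflexive; ↭-sym; ↭-trans; ↭-prep; module PermutationReasoning)
open import Data.List.Relation.Binary.Permutation.Propositional.Properties
  using (map⁺; ++⁺; ++⁺ˡ; ++⁺ʳ; ++-comm; shift; shifts; ∷↭∷ʳ; ¬x∷xs↭[]; ↭-reverse; All-resp-↭)
open import Data.List.Relation.Unary.All using (All; []; _∷_)
open import Data.List.Relation.Unary.All.Properties using (applyUpTo⁺₁)
import Data.Maybe.Base as Maybe
open import Data.Maybe.Base using (just)
open import Data.Nat.Base using (ℕ; zero; suc; _+_; _*_; _∸_; _<_; _≤_; ∣_-_∣; s≤s; compare; less; equal; greater)
open import Data.Nat.Induction using (<-wellFounded)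
open import Data.Nat.Properties
open import Data.Nat.Tactic.RingSolver using (solve-∀)
open import Data.Product.Base using (∃; ∃-syntax; _×_; _,_; proj₁; proj₂; map₂; swap)
import Data.Product.Base as Product
open import Data.Sum.Base using (inj₁; inj₂)
open import Induction.WellFounded using (Acc; acc)
open import Function.Base using (id; _∘_)
open import Relation.Nullary.Negation using (contradiction)
open import Relation.Binary.PropositionalEquality using (_≡_; refl; sym; trans; cong; cong₂; subst; module ≡-Reasoning)

-- Ends of lists and neighbouring entries

private
  variable
    A B C : Set

-- A known last entry is the form in which nonemptiness of `xs` is at hand; `last-++` uses a known
-- head likewise.
head-++ : ∀ (xs : List A) {ys a} → last xs ≡ just a → head (xs ++ ys) ≡ head xs
head-++ (_ ∷ _) _ = refl

last-++ : ∀ (xs : List A) {ys b} → head ys ≡ just b → last (xs ++ ys) ≡ last ys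
last-++ []            _            = refl
last-++ (_ ∷ [])      {_ ∷ _} _    = refl
last-++ (_ ∷ x ∷ xs)  eq           = last-++ (x ∷ xs) eq

last-∷ʳ : ∀ (xs : List A) x → last (xs ∷ʳ x) ≡ just x
last-∷ʳ xs x = last-++ xs refl

last-reverse : ∀ (xs : List A) → last (reverse xs) ≡ head xs
last-reverse []       = refl
last-reverse (x ∷ xs) = trans (cong last (unfold-reverse x xs)) (last-∷ʳ (reverse xs) x)

head-reverse : ∀ (xs : List A) → head (reverse xs) ≡ last xs
head-reverse xs = trans (sym (last-reverse (reverse xs))) (cong last (reverse-involutive xs))

-- Used with `_+_` on paths and with `difference` on labels, so that both share the lemmas on
-- joining, shifting and reversing.
pairwise : (A → A → B) → List A → List B
pairwise f []           = []
pairwise f (_ ∷ [])     = []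
pairwise f (x ∷ y ∷ xs) = f x y ∷ pairwise f (y ∷ xs)

pairwise-++ : ∀ (f : A → A → B) xs {ys a b} → last xs ≡ just a → head ys ≡ just b →
              pairwise f (xs ++ ys) ≡ pairwise f xs ++ f a b ∷ pairwise f ys
pairwise-++ f (_ ∷ [])     {_ ∷ _} refl refl = refl
pairwise-++ f (x ∷ y ∷ xs) eqˡ eqʳ = cong (f x y ∷_) (pairwise-++ f (y ∷ xs) eqˡ eqʳ)

pairwise-map : ∀ {f : A → A → B} {g : C → A} {f′ : C → C → C} {h : C → B} →
               (∀ a b → f (g a) (g b) ≡ h (f′ a b)) →
               ∀ xs → pairwise f (map g xs) ≡ map h (pairwise f′ xs)
pairwise-map eq []           = refl
pairwise-map eq (_ ∷ [])     = refl
pairwise-map eq (x ∷ y ∷ xs) = cong₂ _∷_ (eq x y) (pairwise-map eq (y ∷ xs))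

pairwise-reverse : ∀ {f : A → A → B} → (∀ a b → f a b ≡ f b a) →
                   ∀ xs → pairwise f (reverse xs) ↭ pairwise f xs
pairwise-reverse f-comm []           = ↭-refl
pairwise-reverse f-comm (_ ∷ [])     = ↭-refl
pairwise-reverse {f = f} f-comm (x ∷ y ∷ xs) = begin
  pairwise f (reverse (x ∷ y ∷ xs))
    ≡⟨ cong (pairwise f) (unfold-reverse x (y ∷ xs)) ⟩
  pairwise f (reverse (y ∷ xs) ++ [ x ])
    ≡⟨ pairwise-++ f (reverse (y ∷ xs)) (last-reverse (y ∷ xs)) refl ⟩
  pairwise f (reverse (y ∷ xs)) ++ [ f y x ]
    ↭⟨ ∷↭∷ʳ (f y x) (pairwise f (reverse (y ∷ xs))) ⟨
  f y x ∷ pairwise f (reverse (y ∷ xs))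
    ≡⟨ cong (_∷ pairwise f (reverse (y ∷ xs))) (f-comm y x) ⟩
  f x y ∷ pairwise f (reverse (y ∷ xs))
    ↭⟨ ↭-prep _ (pairwise-reverse f-comm (y ∷ xs)) ⟩
  f x y ∷ pairwise f (y ∷ xs) ∎
  where open PermutationReasoning

-- Differences under reversal

difference : ℕ → ℕ → ℕ
difference a b = ∣ b - a ∣

differences-pairwise : ∀ as → differences as ≡ pairwise difference as
differences-pairwise []           = refl
differences-pairwise (_ ∷ [])     = refl
differences-pairwise (a ∷ b ∷ as) = cong (∣ b - a ∣ ∷_) (differences-pairwise (b ∷ as))

reverse-graceful : ∀ {n as} → GracefulPermutation n as → GracefulPermutation n (reverse as)
reverse-graceful {n} {as} g = record
  { arrangement = ↭-trans (↭-reverse as) arrangement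
  ; graceful    = begin
      differences (reverse as)          ≡⟨ differences-pairwise (reverse as) ⟩
      pairwise difference (reverse as)  ↭⟨ pairwise-reverse (λ a b → ∣-∣-comm b a) as ⟩
      pairwise difference as            ≡⟨ differences-pairwise as ⟨
      differences as                    ↭⟨ graceful ⟩
      applyUpTo suc (n ∸ 1)             ∎
  }
  where
  open GracefulPermutation g
  open PermutationReasoning

-- Intervals of labels and their reflection

applyUpTo-+ : ∀ (f : ℕ → A) m n → applyUpTo f (m + n) ≡ applyUpTo f m ++ applyUpTo (f ∘ (m +_)) n
applyUpTo-+ f zero    n = refl
applyUpTo-+ f (suc m) n = cong (f 0 ∷_) (applyUpTo-+ (f ∘ suc) m n)

upTo-+ : ∀ m n → upTo (m + n) ≡ upTo m ++ map (m +_) (upTo n)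
upTo-+ m n = trans (applyUpTo-+ id m n) (cong (upTo m ++_) (sym (map-upTo (m +_) n)))

downFrom↭upTo : ∀ n → downFrom n ↭ upTo n
downFrom↭upTo n = ↭-trans (↭-reflexive (sym (reverse-upTo n))) (↭-reverse (upTo n))

-- Counting from the top label `n - 1`. The same map turns a distance from the top into a label and
-- a sum of neighbours into a difference.
reflect : ℕ → ℕ → ℕ
reflect n k = n ∸ suc k

map-reflect-upTo : ∀ m n → map (reflect (m + n)) (upTo n) ≡ map (m +_) (downFrom n)
map-reflect-upTo m n = trans (map-upTo (reflect (m + n)) n) (go n)
  where
  go : ∀ n → applyUpTo (reflect (m + n)) n ≡ map (m +_) (downFrom n)
  go zero    = refl
  -- `reflect (suc k) (suc l)` computes to `reflect k l`, so the tail is the induction hypothesis.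
  go (suc n) rewrite +-suc m n = cong (m + n ∷_) (go n)

map-reflect-↭ : ∀ m n → map (reflect (m + n)) (upTo n) ↭ map (m +_) (upTo n)
map-reflect-↭ m n = ↭-trans (↭-reflexive (map-reflect-upTo m n)) (map⁺ (m +_) (downFrom↭upTo n))

-- Alternating paths as lists of pairs

flatten : List (A × A) → List A
flatten = concatMap (λ (l , u) → l ∷ u ∷ [])

flatten-++ : ∀ (ps qs : List (A × A)) → flatten (ps ++ qs) ≡ flatten ps ++ flatten qs
flatten-++ = concatMap-++ _

flatten-map : ∀ (f : A → B) ps → flatten (map (Product.map f f) ps) ≡ map f (flatten ps)
flatten-map f []             = refl
flatten-map f ((l , u) ∷ ps) = cong (λ xs → f l ∷ f u ∷ xs) (flatten-map f ps)

-- Read backwards, a path enters each pair from its second component, whence `swap`.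
flatten-reverse : ∀ (ps : List (A × A)) → flatten (reverse (map swap ps)) ≡ reverse (flatten ps)
flatten-reverse []             = refl
flatten-reverse ((l , u) ∷ ps) = begin
  flatten (reverse (map swap ((l , u) ∷ ps)))
    ≡⟨ cong flatten (unfold-reverse (u , l) (map swap ps)) ⟩
  flatten (reverse (map swap ps) ∷ʳ (u , l))
    ≡⟨ flatten-++ (reverse (map swap ps)) _ ⟩
  flatten (reverse (map swap ps)) ++ u ∷ l ∷ []
    ≡⟨ cong (_++ u ∷ l ∷ []) (flatten-reverse ps) ⟩
  reverse (flatten ps) ++ u ∷ l ∷ []
    ≡⟨ reverse-++ (l ∷ u ∷ []) (flatten ps) ⟨
  reverse (flatten ((l , u) ∷ ps)) ∎
  where open ≡-Reasoning

flatten-↭ : ∀ (ps : List (A × A)) → flatten ps ↭ map proj₁ ps ++ map proj₂ ps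
flatten-↭ []             = ↭-refl
flatten-↭ ((l , u) ∷ ps) = ↭-prep l (↭-trans (↭-prep u (flatten-↭ ps))
                             (↭-sym (shift u (map proj₁ ps) (map proj₂ ps))))

-- The pair (l , u) stands for the step from the low label l to the high label
-- N - u, so that a sum of neighbours s in the flattened list stands for the
-- difference N - s.
record AlternatingPath (i j : ℕ) (ps : List (ℕ × ℕ)) : Set where
  field
    lows   : map proj₁ ps ↭ upTo (suc (i + j))
    highs  : map proj₂ ps ↭ upTo (suc (i + j))
    sums   : pairwise _+_ (flatten ps) ↭ upTo (suc ((i + j) + (i + j)))
    starts : head (flatten ps) ≡ just i
    ends   : last (flatten ps) ≡ just j

-- Reversal turns lows into highs, which is harmless because both run through the same interval and
-- sums are symmetric.
reverse-path : ∀ {i j ps} → AlternatingPath i j ps → AlternatingPath j i (reverse (map swap ps))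
reverse-path {i} {j} {ps} path = record
  { lows   = coordinate proj₁ highs
  ; highs  = coordinate proj₂ lows
  ; sums   = begin
      pairwise _+_ (flatten (reverse (map swap ps)))  ≡⟨ cong (pairwise _+_) (flatten-reverse ps) ⟩
      pairwise _+_ (reverse (flatten ps))             ↭⟨ pairwise-reverse +-comm (flatten ps) ⟩
      pairwise _+_ (flatten ps)                       ↭⟨ sums ⟩
      upTo (suc ((i + j) + (i + j)))                  ≡⟨ cong (λ n → upTo (suc (n + n))) (+-comm i j) ⟩
      upTo (suc ((j + i) + (j + i)))                  ∎
  ; starts = trans (cong head (flatten-reverse ps)) (trans (head-reverse (flatten ps)) ends)
  ; ends   = trans (cong last (flatten-reverse ps)) (trans (last-reverse (flatten ps)) starts)
  }
  where
  open AlternatingPath path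
  open PermutationReasoning
  coordinate : ∀ (π : ℕ × ℕ → ℕ) → map (π ∘ swap) ps ↭ upTo (suc (i + j)) →
               map π (reverse (map swap ps)) ↭ upTo (suc (j + i))
  coordinate π p = begin
    map π (reverse (map swap ps))  ↭⟨ map⁺ π (↭-reverse (map swap ps)) ⟩
    map π (map swap ps)            ≡⟨ map-∘ ps ⟨
    map (π ∘ swap) ps              ↭⟨ p ⟩
    upTo (suc (i + j))             ≡⟨ cong (upTo ∘ suc) (+-comm i j) ⟩
    upTo (suc (j + i))             ∎

-- Prefixing a zigzag

zigzag : ℕ → List (ℕ × ℕ)
zigzag i = map (λ k → k , k) (downFrom (suc i))

-- The pair k, k contributes 2 k, and the step from it down to k - 1 contributes 2 k - 1.
zigzag-sums : ∀ i → pairwise _+_ (flatten (zigzag i)) ≡ downFrom (suc (i + i))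
zigzag-sums zero    = refl
zigzag-sums (suc i) rewrite +-suc i i = cong (λ xs → suc (suc (i + i)) ∷ suc (i + i) ∷ xs) (zigzag-sums i)

zigzag-last : ∀ i → last (flatten (zigzag i)) ≡ just 0
zigzag-last zero    = refl
zigzag-last (suc i) = zigzag-last i

module _ {i j ps} (path : AlternatingPath i j ps) where
  open AlternatingPath path

  private
    shifted : List (ℕ × ℕ)
    shifted = map (Product.map (suc i +_) (suc i +_)) ps

    flatten-shifted : flatten shifted ≡ map (suc i +_) (flatten ps)
    flatten-shifted = flatten-map (suc i +_) ps

    starts-shifted : head (flatten shifted) ≡ just (suc i + i)
    starts-shifted = trans (cong head flatten-shifted)
      (trans (head-map (flatten ps)) (cong (Maybe.map (suc i +_)) starts))

    ends-shifted : last (flatten shifted) ≡ just (suc i + j)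
    ends-shifted = trans (cong last flatten-shifted)
      (trans (last-map _ (flatten ps)) (cong (Maybe.map (suc i +_)) ends))

    sums-shifted : pairwise _+_ (flatten shifted) ≡ map (suc i + suc i +_) (pairwise _+_ (flatten ps))
    sums-shifted = trans (cong (pairwise _+_) flatten-shifted)
      (pairwise-map (regroup (suc i)) (flatten ps))
      where
      regroup : ∀ k a b → (k + a) + (k + b) ≡ (k + k) + (a + b)
      regroup = solve-∀

    coordinate : ∀ (π : ℕ × ℕ → ℕ) → map π (zigzag i) ≡ downFrom (suc i) →
                 map π shifted ≡ map (suc i +_) (map π ps) → map π ps ↭ upTo (suc (i + j)) →
                 map π (zigzag i ++ shifted) ↭ upTo (suc (i + suc (i + j)))
    coordinate π eqᶻ eqˢ p = begin
      map π (zigzag i ++ shifted)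
        ≡⟨ map-++ π (zigzag i) shifted ⟩
      map π (zigzag i) ++ map π shifted
        ≡⟨ cong₂ _++_ eqᶻ eqˢ ⟩
      downFrom (suc i) ++ map (suc i +_) (map π ps)
        ↭⟨ ++⁺ (downFrom↭upTo (suc i)) (map⁺ (suc i +_) p) ⟩
      upTo (suc i) ++ map (suc i +_) (upTo (suc (i + j)))
        ≡⟨ upTo-+ (suc i) (suc (i + j)) ⟨
      upTo (suc (i + suc (i + j))) ∎
      where open PermutationReasoning

  -- The zigzag uses the entries 0, ..., i on both sides and the sums 0, ..., 2 i. It ends in 0 and
  -- the shifted path starts with 2 i + 1, so the joint has the sum 2 i + 1; shifting both
  -- neighbours by i + 1 moves the remaining sums to 2 i + 2 and beyond.
  zigzag-extend : AlternatingPath i (suc (i + j)) (zigzag i ++ shifted)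
  zigzag-extend = record
    { lows   = coordinate proj₁ (trans (sym (map-∘ (downFrom (suc i)))) (map-id _))
                 (trans (sym (map-∘ ps)) (map-∘ ps)) lows
    ; highs  = coordinate proj₂ (trans (sym (map-∘ (downFrom (suc i)))) (map-id _))
                 (trans (sym (map-∘ ps)) (map-∘ ps)) highs
    ; sums   = begin
        pairwise _+_ (flatten (zigzag i ++ shifted))
          ≡⟨ cong (pairwise _+_) (flatten-++ (zigzag i) shifted) ⟩
        pairwise _+_ (flatten (zigzag i) ++ flatten shifted)
          ≡⟨ pairwise-++ _+_ (flatten (zigzag i)) (zigzag-last i) starts-shifted ⟩
        pairwise _+_ (flatten (zigzag i)) ++ (suc i + i) ∷ pairwise _+_ (flatten shifted)
          ≡⟨ cong₂ (λ xs ys → xs ++ (suc i + i) ∷ ys) (zigzag-sums i) sums-shifted ⟩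
        downFrom (suc (i + i)) ++ (suc i + i) ∷ map (suc i + suc i +_) (pairwise _+_ (flatten ps))
          ↭⟨ shift (suc i + i) (downFrom (suc (i + i))) _ ⟩
        downFrom (suc (suc i + i)) ++ map (suc i + suc i +_) (pairwise _+_ (flatten ps))
          ↭⟨ ++⁺ (downFrom↭upTo (suc (suc i + i))) (map⁺ (suc i + suc i +_) sums) ⟩
        upTo (suc (suc i + i)) ++ map (suc i + suc i +_) (upTo (suc ((i + j) + (i + j))))
          ≡⟨ cong (λ k → upTo k ++ map (suc i + suc i +_) (upTo (suc ((i + j) + (i + j))))) (+-suc (suc i) i) ⟨
        upTo (suc i + suc i) ++ map (suc i + suc i +_) (upTo (suc ((i + j) + (i + j))))
          ≡⟨ upTo-+ (suc i + suc i) _ ⟨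
        upTo (suc i + suc i + suc ((i + j) + (i + j)))
          ≡⟨ cong upTo (regroup i j) ⟩
        upTo (suc ((i + suc (i + j)) + (i + suc (i + j)))) ∎
    ; starts = refl
    ; ends   = trans (cong last (flatten-++ (zigzag i) shifted))
                 (trans (last-++ (flatten (zigzag i)) starts-shifted) ends-shifted)
    }
    where
    open PermutationReasoning
    regroup : ∀ i j → suc i + suc i + suc ((i + j) + (i + j)) ≡ suc ((i + suc (i + j)) + (i + suc (i + j)))
    regroup = solve-∀

-- Paths with equal end entries, and existence by descent

descent : ℕ → ℕ → List (ℕ × ℕ)
descent c n = map (λ k → c + suc k , c + k) (downFrom n)

-- A pair k + 1, k gives 2 k + 1, and the next pair starts with k again, giving 2 k. The last pair
-- has no successor; the entry 0 after it supplies the sum 0.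
descent-++-sums : ∀ n xs → pairwise _+_ (flatten (descent 0 n) ++ 0 ∷ xs) ≡ downFrom (n + n) ++ pairwise _+_ (0 ∷ xs)
descent-++-sums zero          xs = refl
descent-++-sums (suc zero)    xs = refl
descent-++-sums (suc (suc n)) xs = trans
  (cong (λ ys → suc (suc (n + suc n)) ∷ suc (n + suc n) ∷ ys) (descent-++-sums (suc n) xs))
  (cong (λ k → downFrom (suc (suc k)) ++ pairwise _+_ (0 ∷ xs)) (sym (+-suc n (suc n))))

-- The entry in front doubles the first low, which adds the top sum 2 (c + n); the sums then fall by
-- one down to 2 c + 1.
∷-descent-sums : ∀ c n → pairwise _+_ ((c + n) ∷ flatten (descent c n)) ≡ map (suc (c + c) +_) (downFrom (n + n))
∷-descent-sums c zero    = refl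
∷-descent-sums c (suc n) rewrite +-suc n n =
  cong₂ _∷_ (regroup₁ c n) (cong₂ _∷_ (regroup₂ c n) (∷-descent-sums c n))
  where
  regroup₁ : ∀ c n → (c + suc n) + (c + suc n) ≡ suc (c + c) + suc (n + n)
  regroup₁ = solve-∀
  regroup₂ : ∀ c n → (c + suc n) + (c + n) ≡ suc (c + c) + (n + n)
  regroup₂ = solve-∀

balanced : ℕ → List (ℕ × ℕ)
balanced i = descent 0 i ++ (0 , i + i) ∷ descent i i

-- The entry in front covers `n = 0`, where the descent itself has no last entry.
∷-descent-last : ∀ c n → last ((c + n) ∷ flatten (descent c n)) ≡ just c
∷-descent-last c zero    = cong just (+-identityʳ c)
∷-descent-last c (suc n) = ∷-descent-last c n

-- The path is i, i - 1, i - 1, ..., 1, 0, then 0, 2 i, then 2 i, 2 i - 1, 2 i - 1, ..., i + 1, i.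
-- Its three stretches have the sums 2 i - 1, ..., 0, then 2 i, then 4 i, ..., 2 i + 1.
balanced-path : ∀ i → AlternatingPath i i (balanced i)
balanced-path i = record
  { lows   = begin
      map proj₁ (balanced i)
        ≡⟨ map-++ proj₁ (descent 0 i) _ ⟩
      map proj₁ (descent 0 i) ++ 0 ∷ map proj₁ (descent i i)
        ≡⟨ cong₂ (λ xs ys → xs ++ 0 ∷ ys) (map-∘ (downFrom i)) (map-∘ (downFrom i)) ⟨
      map suc (downFrom i) ++ 0 ∷ map (λ k → i + suc k) (downFrom i)
        ↭⟨ shift 0 (map suc (downFrom i)) _ ⟩
      0 ∷ map suc (downFrom i) ++ map (λ k → i + suc k) (downFrom i)
        ≡⟨ cong (λ xs → 0 ∷ map suc (downFrom i) ++ xs)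
                (trans (map-cong (+-suc i) (downFrom i)) (map-∘ (downFrom i))) ⟩
      0 ∷ map suc (downFrom i) ++ map suc (map (i +_) (downFrom i))
        ≡⟨ cong (0 ∷_) (map-++ suc (downFrom i) _) ⟨
      0 ∷ map suc (downFrom i ++ map (i +_) (downFrom i))
        ↭⟨ ↭-prep 0 (map⁺ suc downFrom-double) ⟩
      0 ∷ map suc (upTo (i + i))
        ≡⟨ cong (0 ∷_) (map-upTo suc (i + i)) ⟩
      upTo (suc (i + i)) ∎
  ; highs  = begin
      map proj₂ (balanced i)
        ≡⟨ map-++ proj₂ (descent 0 i) _ ⟩
      map proj₂ (descent 0 i) ++ (i + i) ∷ map proj₂ (descent i i)
        ≡⟨ cong₂ (λ xs ys → xs ++ (i + i) ∷ ys)
             (trans (sym (map-id _)) (map-∘ (downFrom i))) (map-∘ (downFrom i)) ⟨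
      downFrom i ++ (i + i) ∷ map (i +_) (downFrom i)
        ↭⟨ shift (i + i) (downFrom i) _ ⟩
      (i + i) ∷ downFrom i ++ map (i +_) (downFrom i)
        ↭⟨ ↭-prep (i + i) downFrom-double ⟩
      (i + i) ∷ upTo (i + i)
        ↭⟨ ∷↭∷ʳ (i + i) (upTo (i + i)) ⟩
      upTo (i + i) ∷ʳ (i + i)
        ≡⟨ upTo-∷ʳ (i + i) ⟩
      upTo (suc (i + i)) ∎
  ; sums   = begin
      pairwise _+_ (flatten (balanced i))
        ≡⟨ cong (pairwise _+_) (flatten-++ (descent 0 i) _) ⟩
      pairwise _+_ (flatten (descent 0 i) ++ 0 ∷ (i + i) ∷ flatten (descent i i))
        ≡⟨ descent-++-sums i _ ⟩
      downFrom (i + i) ++ (i + i) ∷ pairwise _+_ ((i + i) ∷ flatten (descent i i))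
        ≡⟨ cong (λ xs → downFrom (i + i) ++ (i + i) ∷ xs) (∷-descent-sums i i) ⟩
      downFrom (i + i) ++ (i + i) ∷ map (suc (i + i) +_) (downFrom (i + i))
        ↭⟨ shift (i + i) (downFrom (i + i)) _ ⟩
      downFrom (suc (i + i)) ++ map (suc (i + i) +_) (downFrom (i + i))
        ↭⟨ ++⁺ (downFrom↭upTo (suc (i + i))) (map⁺ (suc (i + i) +_) (downFrom↭upTo (i + i))) ⟩
      upTo (suc (i + i)) ++ map (suc (i + i) +_) (upTo (i + i))
        ≡⟨ upTo-+ (suc (i + i)) (i + i) ⟨
      upTo (suc ((i + i) + (i + i))) ∎
  ; starts = balanced-head i
  ; ends   = trans (cong last (flatten-++ (descent 0 i) _))
               (trans (last-++ (flatten (descent 0 i)) refl) (∷-descent-last i i))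
  }
  where
  open PermutationReasoning
  downFrom-double : downFrom i ++ map (i +_) (downFrom i) ↭ upTo (i + i)
  downFrom-double = ↭-trans (++⁺ (downFrom↭upTo i) (map⁺ (i +_) (downFrom↭upTo i)))
                            (↭-reflexive (sym (upTo-+ i i)))
  balanced-head : ∀ i → head (flatten (balanced i)) ≡ just i
  balanced-head zero    = refl
  balanced-head (suc i) = refl

-- In terms of i + 1 and j + 1 each step subtracts the smaller number from the larger. Both stay
-- positive, so the descent can only stop at equality.
alternatingPath : ∀ i j → ∃ (AlternatingPath i j)
alternatingPath i j = go i j (<-wellFounded (i + j))
  where
  go : ∀ i j → Acc _<_ (i + j) → ∃ (AlternatingPath i j)
  go i j (acc rec) with compare i j
  ... | less .i k    = _ , zigzag-extend (proj₂ (go i k (rec (+-monoʳ-< i (s≤s (m≤n+m k i))))))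
  ... | equal .i     = _ , balanced-path i
  ... | greater .j k = _ , reverse-path (zigzag-extend (proj₂ (go j k (rec (s≤s (m≤m+n (j + k) j))))))

-- From paths to labels

realise : ℕ → List (ℕ × ℕ) → List ℕ
realise n ps = flatten (map (map₂ (reflect n)) ps)

-- The bound puts the high label `n - 1 - u` at or above `l`, so the absolute difference is a
-- subtraction without truncation.
low-high-difference : ∀ {n} l u → l + u < n → ∣ reflect n u - l ∣ ≡ reflect n (l + u)
low-high-difference {n} l u l+u<n = begin
  ∣ reflect n u - l ∣  ≡⟨ m≤n⇒∣n-m∣≡n∸m (m+n≤o⇒m≤o∸n l (subst (_≤ n) (sym (+-suc l u)) l+u<n)) ⟩
  n ∸ suc u ∸ l        ≡⟨ ∸-+-assoc n (suc u) l ⟩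
  n ∸ (suc u + l)      ≡⟨ cong (λ k → n ∸ suc k) (+-comm u l) ⟩
  reflect n (l + u)    ∎
  where open ≡-Reasoning

realise-differences : ∀ {n} ps → All (_< n) (pairwise _+_ (flatten ps)) →
                      pairwise difference (realise n ps) ≡ map (reflect n) (pairwise _+_ (flatten ps))
realise-differences []                             []       = refl
realise-differences ((l , u) ∷ [])                 (lu ∷ []) = cong [_] (low-high-difference l u lu)
realise-differences {n} ((l , u) ∷ ps@((l′ , _) ∷ _)) (lu ∷ ul′ ∷ s) =
  cong₂ _∷_ (low-high-difference l u lu) (cong₂ _∷_
    -- The edge back from the high side to the next low one is the same computation up to symmetry.
    (begin
      ∣ l′ - reflect n u ∣  ≡⟨ ∣-∣-comm l′ (reflect n u) ⟩
      ∣ reflect n u - l′ ∣  ≡⟨ low-high-difference l′ u (subst (_< n) (+-comm u l′) ul′) ⟩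
      reflect n (l′ + u)    ≡⟨ cong (reflect n) (+-comm l′ u) ⟩
      reflect n (u + l′)    ∎)
    (realise-differences ps s))
  where open ≡-Reasoning

realise-↭ : ∀ n ps → realise n ps ↭ map proj₁ ps ++ map (reflect n) (map proj₂ ps)
realise-↭ n ps = ↭-trans (flatten-↭ (map (map₂ (reflect n)) ps)) (↭-reflexive
  (cong₂ _++_ (sym (map-∘ ps)) (trans (sym (map-∘ ps)) (map-∘ ps))))

realise-head : ∀ n ps → head (realise n ps) ≡ head (flatten ps)
realise-head n []      = refl
realise-head n (_ ∷ _) = refl

-- A flattened list ends in a second component, so its last entry is a high one and gets reflected,
-- unlike its head.
realise-last : ∀ n ps → last (realise n ps) ≡ Maybe.map (reflect n) (last (flatten ps))
realise-last n []               = refl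
realise-last n (_ ∷ [])         = refl
realise-last n (_ ∷ ps@(_ ∷ _)) = realise-last n ps

-- Inserting the path between x and y

module _ {q us vs x d} (g : GracefulPermutation (suc q) (us ++ vs))
         (us-last : last us ≡ just x) (vs-head : head vs ≡ just (x + d))
         -- With y = `x + d`, `j` is the room p - 1 - y, so that y and `j` are admissible ends of a
         -- path on p lows and p highs.
         {j} (d+d≡p : d + d ≡ suc (x + d + j)) where
  open GracefulPermutation g

  private
    p size : ℕ
    p    = suc (x + d + j)
    size = p + suc q + p

    ps : List (ℕ × ℕ)
    ps = proj₁ (alternatingPath (x + d) j)

    open AlternatingPath (proj₂ (alternatingPath (x + d) j))

    path us⁺ vs⁺ : List ℕ
    path = realise size ps
    us⁺  = map (p +_) us
    vs⁺  = map (p +_) vs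

    us⁺-last : last us⁺ ≡ just (p + x)
    us⁺-last = trans (last-map _ us) (cong (Maybe.map (p +_)) us-last)

    vs⁺-head : head vs⁺ ≡ just (p + (x + d))
    vs⁺-head = trans (head-map vs) (cong (Maybe.map (p +_)) vs-head)

    path-head : head path ≡ just (x + d)
    path-head = trans (realise-head size ps) starts

    path-last : last path ≡ just (reflect size j)
    path-last = trans (realise-last size ps) (cong (Maybe.map (reflect size)) ends)

    differences-shift : ∀ xs → pairwise difference (map (p +_) xs) ≡ differences xs
    differences-shift xs = begin
      pairwise difference (map (p +_) xs)  ≡⟨ pairwise-map (λ a b → ∣m+n-m+o∣≡∣n-o∣ p b a) xs ⟩
      map id (pairwise difference xs)      ≡⟨ map-id _ ⟩
      pairwise difference xs               ≡⟨ differences-pairwise xs ⟨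
      differences xs                       ∎
      where open ≡-Reasoning

    edges : ℕ
    edges = suc ((x + d + j) + (x + d + j))

    -- A path with 2 p entries has 2 p - 1 `edges`. Below their differences lie 0, the old
    -- differences up to `q`, and `suc q` for the edge leaving the path.
    size≡ : size ≡ suc (suc q) + edges
    size≡ = regroup (x + d + j) q
      where
      regroup : ∀ s q → suc s + suc q + suc s ≡ suc (suc q) + suc (s + s)
      regroup = solve-∀

    -- A sum s becomes the difference `size - 1 - s`, so the lowest `edges` numbers are reflected
    -- onto the highest ones below `size`.
    path-differences : pairwise difference path ↭ map (suc (suc q) +_) (upTo edges)
    path-differences = begin
      pairwise difference path
        ≡⟨ realise-differences ps (All-resp-↭ (↭-sym sums) (applyUpTo⁺₁ id edges bound)) ⟩
      map (reflect size) (pairwise _+_ (flatten ps))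
        ↭⟨ map⁺ (reflect size) sums ⟩
      map (reflect size) (upTo edges)
        ≡⟨ cong (λ n → map (reflect n) (upTo edges)) size≡ ⟩
      map (reflect (suc (suc q) + edges)) (upTo edges)
        ↭⟨ map-reflect-↭ (suc (suc q)) edges ⟩
      map (suc (suc q) +_) (upTo edges) ∎
      where
      open PermutationReasoning
      bound : ∀ {s} → s < edges → s < size
      bound {s} s< = subst (s <_) (sym size≡) (≤-trans s< (m≤n+m edges (suc (suc q))))

    -- Since p = 2 d, the label `p + x` is y + d: the edge into the path has the same difference d
    -- as the removed edge.
    first-difference : difference (p + x) (x + d) ≡ difference x (x + d)
    first-difference = begin
      ∣ (x + d) - (p + x) ∣        ≡⟨ cong (λ n → ∣ (x + d) - (n + x) ∣) d+d≡p ⟨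
      ∣ (x + d) - (d + d + x) ∣    ≡⟨ cong (∣ (x + d) -_∣) (regroup x d) ⟩
      ∣ (x + d) - (x + d + d) ∣    ≡⟨ ∣m-m+n∣≡n (x + d) d ⟩
      d                            ≡⟨ ∣m-m+n∣≡n x d ⟨
      ∣ x - (x + d) ∣              ≡⟨ ∣-∣-comm x (x + d) ⟩
      ∣ (x + d) - x ∣              ∎
      where
      open ≡-Reasoning
      regroup : ∀ x d → d + d + x ≡ x + d + d
      regroup = solve-∀

    -- Since p = y + j + 1, the label at distance `j` from the top is `p + y + suc q`.
    last-difference : difference (reflect size j) (p + (x + d)) ≡ suc q
    last-difference = begin
      ∣ p + (x + d) - reflect size j ∣          ≡⟨ cong (∣ p + (x + d) -_∣) reflect-j ⟩
      ∣ p + (x + d) - (p + (x + d) + suc q) ∣   ≡⟨ ∣m-m+n∣≡n (p + (x + d)) (suc q) ⟩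
      suc q                                     ∎
      where
      open ≡-Reasoning
      regroup : ∀ p y j q → p + suc q + suc (y + j) ≡ (p + y + suc q) + suc j
      regroup = solve-∀
      reflect-j : reflect size j ≡ p + (x + d) + suc q
      reflect-j = trans (cong (_∸ suc j) (regroup p (x + d) j q)) (m+n∸n≡m _ (suc j))

    -- Gathers the kept edges around the edge into the path, and moves the path's own edges behind
    -- the edge that leaves it.
    swap-around : ∀ (as bs cs : List ℕ) {a b} →
                  as ++ a ∷ bs ++ b ∷ cs ↭ (as ++ a ∷ cs) ++ b ∷ bs
    swap-around as bs cs {a} {b} = begin
      as ++ a ∷ bs ++ b ∷ cs    ↭⟨ ++⁺ˡ as (↭-prep a (++-comm bs (b ∷ cs))) ⟩
      as ++ a ∷ b ∷ cs ++ bs    ↭⟨ ++⁺ˡ as (↭-prep a (shift b cs bs)) ⟨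
      as ++ a ∷ cs ++ b ∷ bs    ≡⟨ ++-assoc as (a ∷ cs) (b ∷ bs) ⟨
      (as ++ a ∷ cs) ++ b ∷ bs  ∎
      where open PermutationReasoning

    path++vs⁺-head : head (path ++ vs⁺) ≡ just (x + d)
    path++vs⁺-head = trans (head-++ path path-last) path-head

    old-differences : pairwise difference us⁺ ++ difference (p + x) (x + d) ∷ pairwise difference vs⁺
                      ≡ differences (us ++ vs)
    old-differences = begin
      pairwise difference us⁺ ++ difference (p + x) (x + d) ∷ pairwise difference vs⁺
        ≡⟨ cong₂ _++_ (differences-shift us) (cong₂ _∷_ first-difference (differences-shift vs)) ⟩
      differences us ++ difference x (x + d) ∷ differences vs
        ≡⟨ cong₂ (λ as bs → as ++ _ ∷ bs) (differences-pairwise us) (differences-pairwise vs) ⟩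
      pairwise difference us ++ difference x (x + d) ∷ pairwise difference vs
        ≡⟨ pairwise-++ difference us us-last vs-head ⟨
      pairwise difference (us ++ vs)
        ≡⟨ differences-pairwise (us ++ vs) ⟨
      differences (us ++ vs) ∎
      where open ≡-Reasoning

  inserted : List ℕ
  inserted = us⁺ ++ path ++ vs⁺

  inserted-graceful : GracefulPermutation size inserted
  inserted-graceful = record
    { arrangement = begin
        us⁺ ++ path ++ vs⁺
          ↭⟨ shifts us⁺ path ⟩
        path ++ us⁺ ++ vs⁺
          ≡⟨ cong (path ++_) (map-++ (p +_) us vs) ⟨
        path ++ map (p +_) (us ++ vs)
          ↭⟨ ++⁺ (realise-↭ size ps) (map⁺ (p +_) arrangement) ⟩
        (map proj₁ ps ++ map (reflect size) (map proj₂ ps)) ++ middle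
          ↭⟨ ++⁺ʳ middle (++⁺ lows (↭-trans (map⁺ (reflect size) highs) (map-reflect-↭ (p + suc q) p))) ⟩
        (upTo p ++ top) ++ middle
          ≡⟨ ++-assoc (upTo p) top middle ⟩
        upTo p ++ top ++ middle
          -- In increasing order: low labels, shifted old labels, high labels.
          ↭⟨ ++⁺ˡ (upTo p) (++-comm top middle) ⟩
        upTo p ++ middle ++ top
          ≡⟨ ++-assoc (upTo p) middle top ⟨
        (upTo p ++ middle) ++ top
          ≡⟨ cong (_++ top) (upTo-+ p (suc q)) ⟨
        upTo (p + suc q) ++ top
          ≡⟨ upTo-+ (p + suc q) p ⟨
        upTo size ∎
    ; graceful    = begin
        differences inserted
          ≡⟨ differences-pairwise inserted ⟩
        pairwise difference inserted
          ≡⟨ pairwise-++ difference us⁺ us⁺-last path++vs⁺-head ⟩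
        pairwise difference us⁺ ++ difference (p + x) (x + d) ∷ pairwise difference (path ++ vs⁺)
          ≡⟨ cong (λ es → pairwise difference us⁺ ++ difference (p + x) (x + d) ∷ es) (pairwise-++ difference path path-last vs⁺-head) ⟩
        pairwise difference us⁺ ++ difference (p + x) (x + d) ∷
          pairwise difference path ++ difference (reflect size j) (p + (x + d)) ∷ pairwise difference vs⁺
          ↭⟨ swap-around (pairwise difference us⁺) (pairwise difference path) (pairwise difference vs⁺) ⟩
        (pairwise difference us⁺ ++ difference (p + x) (x + d) ∷ pairwise difference vs⁺) ++
          difference (reflect size j) (p + (x + d)) ∷ pairwise difference path
          ≡⟨ cong₂ _++_ old-differences (cong (_∷ pairwise difference path) last-difference) ⟩
        differences (us ++ vs) ++ suc q ∷ pairwise difference path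
          -- The three blocks are 1, ..., q, then q + 1, then q + 2, ..., `size - 1`.
          ↭⟨ ++⁺ graceful (↭-prep (suc q) path-differences) ⟩
        applyUpTo suc q ++ suc q ∷ map (suc (suc q) +_) (upTo edges)
          ≡⟨ ++-assoc (applyUpTo suc q) [ suc q ] _ ⟨
        (applyUpTo suc q ∷ʳ suc q) ++ map (suc (suc q) +_) (upTo edges)
          ≡⟨ cong₂ _++_ (applyUpTo-∷ʳ suc q) (map-upTo (suc (suc q) +_) edges) ⟩
        applyUpTo suc (suc q) ++ applyUpTo (suc ∘ (suc q +_)) edges
          ≡⟨ applyUpTo-+ suc (suc q) edges ⟨
        applyUpTo suc (suc q + edges)
          ≡⟨ cong (applyUpTo suc ∘ (_∸ 1)) size≡ ⟨
        applyUpTo suc (size ∸ 1) ∎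
    }
    where
    open PermutationReasoning
    middle top : List ℕ
    middle = map (p +_) (upTo (suc q))
    top    = map (p + suc q +_) (upTo p)

  inserted-head : head inserted ≡ Maybe.map (p +_) (head (us ++ vs))
  inserted-head = trans (head-++ us⁺ us⁺-last)
    (trans (head-map us) (cong (Maybe.map (p +_)) (sym (head-++ us us-last))))

  inserted-last : last inserted ≡ Maybe.map (p +_) (last (us ++ vs))
  inserted-last = trans (last-++ us⁺ path++vs⁺-head)
    (trans (last-++ path vs⁺-head)
      (trans (last-map _ vs) (cong (Maybe.map (p +_)) (sym (last-++ us vs-head)))))

-- Both orders of x and y

Extension : ℕ → ℕ → List ℕ → Set
Extension q p as = ∃[ bs ] (GracefulPermutation (2 * p + q) bs
  × head bs ≡ Maybe.map (p +_) (head as) × last bs ≡ Maybe.map (p +_) (last as))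

extend-consecutive : ∀ {q as x d p} → GracefulPermutation q as → Consecutive x (x + d) as →
                     d + d ≡ p → x + d < p → Extension q p as
-- The insertion is set up for length `suc q`; the empty permutation has no adjacent entries.
extend-consecutive {zero} g (us , vs , refl) _ _ = contradiction
  (↭-trans (↭-sym (shift _ us _)) (GracefulPermutation.arrangement g)) ¬x∷xs↭[]
extend-consecutive {suc q} {x = x} {d} g (us , vs , refl) d+d≡p y<p
  with j , refl ← m≤n⇒∃[o]m+o≡n y<p
  -- Rebracketing places the cut between x and y.
  rewrite sym (++-assoc us [ x ] (x + d ∷ vs))
  = inserted g last-us refl d+d≡p
  , subst (λ n → GracefulPermutation n (inserted g last-us refl d+d≡p)) (regroup (suc (x + d + j)) (suc q))
      (inserted-graceful g last-us refl d+d≡p)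
  , inserted-head g last-us refl d+d≡p
  , inserted-last g last-us refl d+d≡p
  where
  last-us = last-∷ʳ us x
  regroup : ∀ p q → p + q + p ≡ 2 * p + q
  regroup = solve-∀

consecutive-reverse : ∀ {x y as} → Consecutive y x as → Consecutive x y (reverse as)
consecutive-reverse {x} {y} (us , vs , refl) = reverse vs , reverse us , (begin
  reverse (us ++ y ∷ x ∷ vs)               ≡⟨ reverse-++ us (y ∷ x ∷ vs) ⟩
  reverse (y ∷ x ∷ vs) ++ reverse us       ≡⟨ cong (_++ reverse us) (reverse-++ (y ∷ x ∷ []) vs) ⟩
  (reverse vs ++ x ∷ y ∷ []) ++ reverse us ≡⟨ ++-assoc (reverse vs) (x ∷ y ∷ []) (reverse us) ⟩
  reverse vs ++ x ∷ y ∷ reverse us         ∎)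
  where open ≡-Reasoning

extend-adjacent : ∀ {q as x d p} → GracefulPermutation q as → Adjacent x (x + d) as →
                  d + d ≡ p → x + d < p → Extension q p as
extend-adjacent g (inj₁ xy) d+d≡p y<p = extend-consecutive g xy d+d≡p y<p
extend-adjacent {as = as} {p = p} g (inj₂ yx) d+d≡p y<p
  -- If y comes first, extend the reversed permutation and reverse the result; the two ends change
  -- places twice.
  with bs , g′ , head-bs , last-bs ←
    extend-consecutive (reverse-graceful g) (consecutive-reverse yx) d+d≡p y<p
  = reverse bs , reverse-graceful g′
  , trans (head-reverse bs) (trans last-bs (cong (Maybe.map (p +_)) (last-reverse as)))
  , trans (last-reverse bs) (trans head-bs (cong (Maybe.map (p +_)) (head-reverse as)))

theorem5p6 : (q : ℕ) (as : List ℕ) → GracefulPermutation q as →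
    (a₁ aq : ℕ) → head as ≡ just a₁ → last as ≡ just aq →
    (x y : ℕ) → Adjacent x y as → x < y → y < 2 * (y ∸ x) →
    (p : ℕ) → p ≡ 2 * (y ∸ x) →
    ∃[ bs ] (GracefulPermutation (2 * p + q) bs × head bs ≡ just (a₁ + p) × last bs ≡ just (aq + p))
theorem5p6 q as g a₁ aq head-as last-as x y adjacent x<y y<p p refl =
  let bs , g′ , head-bs , last-bs = extend-adjacent {x = x} {d = y ∸ x} g
        (subst (λ z → Adjacent x z as) y≡x+d adjacent)
        -- `2 * d` computes to `d + (d + 0)`.
        (cong (y ∸ x +_) (sym (+-identityʳ (y ∸ x))))
        (subst (_< p) y≡x+d y<p)
  in bs , g′ , shifted head-bs head-as , shifted last-bs last-as
  where
  y≡x+d : y ≡ x + (y ∸ x)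
  y≡x+d = sym (m+[n∸m]≡n (<⇒≤ x<y))
  shifted : ∀ {b a c} → b ≡ Maybe.map (p +_) a → a ≡ just c → b ≡ just (c + p)
  shifted refl refl = cong just (+-comm p _)
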